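{- Let $H$ be a disjoint union of $2$-connected graphs $H_1, H_2, \ldots, H_k$. Then $$c(H) \leq c(H_1)+c(H_2)+\ldots+c(H_k)+k-1.$$
   Context: All graphs are finite and simple. For a graph $G$, $v(G)$ and $e(G)$ denote its numbers of vertices and edges. A graph $H$ is a minor of $G$ if a graph isomorphic to $H$ can be obtained from a subgraph of $G$ by contracting edges. For a graph $H$ with $v(H)\ge 2$, $c(H)$ is the supremum of $e(G)/v(G)$ over all non-null graphs $G$ (i.e. $v(G)\ge 1$) not containing $H$ as a minor. -}

module Defs where

open import Data.Nat as ℕ using (ℕ; zero; suc; _≤_)
open import Data.Fin as Fin using (Fin; zero; suc; splitAt; toℕ)
open import Data.Fin.Properties using (_≟_)
open import Data.Sum using (_⊎_; inj₁; inj₂)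
open import Data.Bool using (Bool; true; false; _∧_; if_then_else_)
open import Data.Product using (Σ; _×_; _,_; ∃)
open import Data.Maybe using (Maybe; just; nothing)
open import Data.Empty using (⊥)
open import Data.Integer using (+_)
open import Data.Rational as ℚ using (ℚ)
open import Relation.Nullary using (¬_; does)
open import Relation.Binary.PropositionalEquality using (_≡_; refl)

record Graph : Set where
  field
    n     : ℕ
    adj   : Fin n → Fin n → Bool
    sym   : ∀ x y → adj x y ≡ adj y x
    irrefl : ∀ x → adj x x ≡ false
open Graph public

v : Graph → ℕ
v G = n G

sumFin : (m : ℕ) → (Fin m → ℕ) → ℕ
sumFin zero    f = 0
sumFin (suc m) f = f zero ℕ.+ sumFin m (λ i → f (suc i))

e : Graph → ℕ
e G = sumFin (n G) λ i → sumFin (n G) λ j →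
        if does (i Fin.<? j) ∧ adj G i j then 1 else 0

data WalkIn (G : Graph) (P : Fin (n G) → Set) : Fin (n G) → Fin (n G) → Set where
  here : ∀ {x} → P x → WalkIn G P x x
  step : ∀ {x y z} → P x → adj G x y ≡ true → WalkIn G P y z → WalkIn G P x z

ConnectedIn : (G : Graph) → (Fin (n G) → Set) → Set
ConnectedIn G P = ∀ x y → P x → P y → WalkIn G P x y

Connected : Graph → Set
Connected G = (1 ≤ n G) × ConnectedIn G (λ _ → Data.Unit.⊤)
  where import Data.Unit

-- 2-connected (Diestel): more than 2 vertices and G − X connected for
-- every set X of fewer than 2 vertices
TwoConnected : Graph → Set
TwoConnected G =
  (3 ≤ n G) × Connected G × (∀ x → ConnectedIn G (λ y → ¬ (y ≡ x)))

-- Minors, via branch sets (minor model).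
-- A model of H in G assigns to each vertex of G at most one vertex of H
-- (so branch sets are disjoint); each branch set is nonempty and induces
-- a connected subgraph of G, and every edge of H is realised by an edge
-- of G between the corresponding branch sets.

record MinorModel (H G : Graph) : Set where
  field
    φ         : Fin (n G) → Maybe (Fin (n H))
    nonempty  : ∀ h → ∃ λ x → φ x ≡ just h
    connected : ∀ h → ConnectedIn G (λ x → φ x ≡ just h)
    edges     : ∀ h h' → adj H h h' ≡ true →
                ∃ λ x → ∃ λ y → φ x ≡ just h × φ y ≡ just h' × adj G x y ≡ true

IsMinor : Graph → Graph → Set
IsMinor H G = MinorModel H G

private
  uadj : ∀ {m k} → (Fin m → Fin m → Bool) → (Fin k → Fin k → Bool) →
         Fin m ⊎ Fin k → Fin m ⊎ Fin k → Bool
  uadj a b (inj₁ x) (inj₁ y) = a x y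
  uadj a b (inj₂ x) (inj₂ y) = b x y
  uadj a b (inj₁ x) (inj₂ y) = false
  uadj a b (inj₂ x) (inj₁ y) = false

  usym : ∀ {m k} (a : Fin m → Fin m → Bool) (b : Fin k → Fin k → Bool) →
         (∀ x y → a x y ≡ a y x) → (∀ x y → b x y ≡ b y x) →
         ∀ p q → uadj a b p q ≡ uadj a b q p
  usym a b sa sb (inj₁ x) (inj₁ y) = sa x y
  usym a b sa sb (inj₂ x) (inj₂ y) = sb x y
  usym a b sa sb (inj₁ x) (inj₂ y) = refl
  usym a b sa sb (inj₂ x) (inj₁ y) = refl

  uirr : ∀ {m k} (a : Fin m → Fin m → Bool) (b : Fin k → Fin k → Bool) →
         (∀ x → a x x ≡ false) → (∀ x → b x x ≡ false) →
         ∀ p → uadj a b p p ≡ false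
  uirr a b ia ib (inj₁ x) = ia x
  uirr a b ia ib (inj₂ x) = ib x

_⊕_ : Graph → Graph → Graph
G ⊕ H = record
  { n      = n G ℕ.+ n H
  ; adj    = λ x y → uadj (adj G) (adj H) (splitAt (n G) x) (splitAt (n G) y)
  ; sym    = λ x y → usym (adj G) (adj H) (sym G) (sym H) (splitAt (n G) x) (splitAt (n G) y)
  ; irrefl = λ x → uirr (adj G) (adj H) (irrefl G) (irrefl H) (splitAt (n G) x)
  }

emptyGraph : Graph
emptyGraph = record { n = 0 ; adj = λ () ; sym = λ () ; irrefl = λ () }

⋃ : (k : ℕ) → (Fin k → Graph) → Graph
⋃ zero    Hs = emptyGraph
⋃ (suc k) Hs = Hs zero ⊕ ⋃ k (λ i → Hs (suc i))

-- Extremal function c(H), expressed through its rational upper bounds.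
-- c(H) = sup { e(G)/v(G) : v(G) ≥ 1, H not a minor of G }.
-- "q is an upper bound for this set", i.e. c(H) ≤ q:

ℕtoℚ : ℕ → ℚ
ℕtoℚ m = + m ℚ./ 1

cBound : Graph → ℚ → Set
cBound H q = ∀ (G : Graph) → 1 ≤ n G → ¬ IsMinor H G →
             ℕtoℚ (e G) ℚ.≤ q ℚ.* ℕtoℚ (v G)

sumℚ : (k : ℕ) → (Fin k → ℚ) → ℚ
sumℚ zero    f = ℚ.0ℚ
sumℚ (suc k) f = f zero ℚ.+ sumℚ k (λ i → f (suc i))

{-# OPTIONS --safe #-}

-- Two ideas. First, copies of an H-minor-free graph glued at one vertex are H-minor-free when H is
-- 2-connected; gluing many copies improves e(G) ≤ c·v(G) to e(G) ≤ c·(v(G) - 1). Second, for s, t ≥ 1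
-- a graph with e(G) > (s + t + 1)(v(G) - 1) has disjoint vertex sets A, B with e(A) > s(|A| - 1) and
-- e(B) > t(|B| - 1). To find them, move vertices one at a time from B to A, starting with |A| = 1,
-- while keeping e(A)/(|A| - 1) + e(B)/(|B| - 1) ≥ s + t + 1; by averaging over B some vertex can always
-- be moved. Consider the move after which e(A) > s(|A| - 1) first holds. If e(B) ≤ t(|B| - 1) then, it
-- follows that e(A) > (s + 1)(|A| - 1), so the inequality for A already held before the move.
-- Bounds below 1 do not occur because K₂ contains no 2-connected minor.

module Submission where

open import Defs
open import Data.Nat
open import Data.Nat.Properties hiding (suc-injective)
open import Data.Nat.Tactic.RingSolver using (solve-∀)
open import Data.Bool using (Bool; true; false; if_then_else_)
open import Data.Fin using (Fin; zero; suc; punchIn; splitAt; join; _↑ˡ_; _↑ʳ_)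
open import Data.Fin.Properties
  using (any?; punchInᵢ≢i; punchIn-injective; suc-injective; injective⇒≤;
         splitAt-join; join-splitAt; splitAt-↑ˡ; splitAt-↑ʳ; splitAt⁻¹-↑ˡ; splitAt⁻¹-↑ʳ)
  renaming (_≟_ to _≟ꟳ_)
open import Data.Integer as ℤ using (-[1+_]; +≤+) renaming (+_ to pos)
import Data.Integer.Properties as ℤ
open import Data.Maybe as Maybe using (Maybe; just; nothing)
open import Data.Maybe.Properties using (just-injective; ≡-dec)
open import Data.Product using (∃; ∃₂; _×_; _,_; proj₁; proj₂)
open import Data.Rational as ℚ using (ℚ; mkℚ; toℚᵘ; 1ℚ; _-_)
import Data.Rational.Properties as ℚ
open import Data.Rational.Solver using (module +-*-Solver)
open import Data.Rational.Unnormalised as ℚᵘ using (mkℚᵘ; *≡*; *≤*)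
import Data.Rational.Unnormalised.Properties as ℚᵘ
open import Data.Sum using (_⊎_; inj₁; inj₂; [_,_]′)
open import Data.Unit using (tt)
open import Data.Vec.Functional using (_∷_)
open import Function using (_∘_; id; const)
open import Function.Definitions using (Injective)
import Relation.Binary.Reasoning.Setoid as SetoidReasoning
open import Relation.Binary.PropositionalEquality renaming (sym to ≡-sym)
open import Relation.Nullary using (Dec; ¬_; yes; no; contradiction)

-- Sums over Fin

sumFin-cong : ∀ m {f g : Fin m → ℕ} → (∀ i → f i ≡ g i) → sumFin m f ≡ sumFin m g
sumFin-cong zero    f≗g = refl
sumFin-cong (suc m) f≗g = cong₂ _+_ (f≗g zero) (sumFin-cong m (f≗g ∘ suc))

sumFin-+ : ∀ m (f g : Fin m → ℕ) → sumFin m (λ i → f i + g i) ≡ sumFin m f + sumFin m g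
sumFin-+ zero    f g = refl
sumFin-+ (suc m) f g rewrite sumFin-+ m (f ∘ suc) (g ∘ suc) =
  interchange (f zero) (g zero) (sumFin m (f ∘ suc)) (sumFin m (g ∘ suc))
  where
  interchange : ∀ a b c d → a + b + (c + d) ≡ a + c + (b + d)
  interchange = solve-∀

sumFin-const : ∀ m c → sumFin m (λ _ → c) ≡ m * c
sumFin-const zero    c = refl
sumFin-const (suc m) c = cong (c +_) (sumFin-const m c)

sumFin-zero : ∀ m → sumFin m (λ _ → 0) ≡ 0
sumFin-zero m = trans (sumFin-const m 0) (*-zeroʳ m)

sumFin-* : ∀ m c (f : Fin m → ℕ) → sumFin m (λ i → c * f i) ≡ c * sumFin m f
sumFin-* zero    c f = ≡-sym (*-zeroʳ c)
sumFin-* (suc m) c f rewrite sumFin-* m c (f ∘ suc) = ≡-sym (*-distribˡ-+ c _ _)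

sumFin-swap : ∀ m n (f : Fin m → Fin n → ℕ) →
  sumFin m (λ i → sumFin n (f i)) ≡ sumFin n (λ j → sumFin m (λ i → f i j))
sumFin-swap zero    n f = ≡-sym (sumFin-zero n)
sumFin-swap (suc m) n f =
  trans (cong (sumFin n (f zero) +_) (sumFin-swap m n (f ∘ suc)))
        (≡-sym (sumFin-+ n (f zero) _))

sumFin-split : ∀ m n (f : Fin (m + n) → ℕ) →
  sumFin (m + n) f ≡ sumFin m (λ i → f (i ↑ˡ n)) + sumFin n (λ j → f (m ↑ʳ j))
sumFin-split zero    n f = refl
sumFin-split (suc m) n f =
  trans (cong (f zero +_) (sumFin-split m n (f ∘ suc))) (≡-sym (+-assoc (f zero) _ _))

sumFin-punchIn : ∀ m (j : Fin (suc m)) (f : Fin (suc m) → ℕ) →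
  sumFin (suc m) f ≡ f j + sumFin m (f ∘ punchIn j)
sumFin-punchIn m       zero    f = refl
sumFin-punchIn (suc m) (suc j) f
  rewrite sumFin-punchIn m j (f ∘ suc) = rotate (f zero) (f (suc j)) _
  where
  rotate : ∀ a b c → a + (b + c) ≡ b + (a + c)
  rotate = solve-∀

sumFin-bound : ∀ m c (f : Fin m → ℕ) → (∀ i → f i ≤ c) → sumFin m f ≤ m * c
sumFin-bound zero    c f f≤c = z≤n
sumFin-bound (suc m) c f f≤c = +-mono-≤ (f≤c zero) (sumFin-bound m c (f ∘ suc) (f≤c ∘ suc))

above-average : ∀ m c (f : Fin m → ℕ) → m * c < sumFin m f → ∃ λ i → c < f i
above-average (suc m) c f mc<Σ with c <? f zero
... | yes c<f₀ = zero , c<f₀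
... | no  c≮f₀ =
  let i , c<fi = above-average m c (f ∘ suc) (+-cancelˡ-< (f zero) _ _
                   (≤-<-trans (+-monoˡ-≤ (m * c) (≮⇒≥ c≮f₀)) mc<Σ))
  in suc i , c<fi

-- Edge counts of induced subgraphs

⟦_⟧ : Bool → ℕ
⟦ b ⟧ = if b then 1 else 0

⟦⟧≤1 : ∀ b → ⟦ b ⟧ ≤ 1
⟦⟧≤1 true  = ≤-refl
⟦⟧≤1 false = z≤n

infixl 4 _∣ᵍ_

-- For injective `ι` this is the subgraph induced by the image of `ι`. With enumerations for vertex
-- sets, deleting and adding a vertex become `∘ punchIn j` and `_∷_`.
_∣ᵍ_ : ∀ (G : Graph) {m} → (Fin m → Fin (n G)) → Graph
G ∣ᵍ ι = record
  { n      = _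
  ; adj    = λ x y → adj G (ι x) (ι y)
  ; sym    = λ x y → sym G (ι x) (ι y)
  ; irrefl = λ x → irrefl G (ι x)
  }

cross : ∀ (G : Graph) {a b} → (Fin a → Fin (n G)) → (Fin b → Fin (n G)) → ℕ
cross G {a} {b} ι κ = sumFin a λ i → sumFin b λ j → ⟦ adj G (ι i) (κ j) ⟧

degree : ∀ (G : Graph) {b} → Fin (n G) → (Fin b → Fin (n G)) → ℕ
degree G {b} x κ = sumFin b λ j → ⟦ adj G x (κ j) ⟧

-- Pairs with `i < j`, as counted by `e`, single out an order of the vertices; the degree sum does
-- not. In the induction, row `zero` and column `zero` contribute the same amount by symmetry.
handshake : ∀ G → sumFin (n G) (λ i → degree G i id) ≡ e G + e G
handshake G = go (n G) (adj G) (sym G) (irrefl G)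
  where
  go : ∀ m (a : Fin m → Fin m → Bool) (s : ∀ x y → a x y ≡ a y x) (r : ∀ x → a x x ≡ false) →
       let G = record { n = m ; adj = a ; sym = s ; irrefl = r } in
       sumFin m (λ i → sumFin m (λ j → ⟦ a i j ⟧)) ≡ e G + e G
  go zero    a s r = refl
  go (suc m) a s r
    rewrite r zero
          | sumFin-+ m (λ i → ⟦ a (suc i) zero ⟧) (λ i → sumFin m (λ j → ⟦ a (suc i) (suc j) ⟧))
          | sumFin-cong m (λ i → cong ⟦_⟧ (s (suc i) zero))
          | go m (λ i j → a (suc i) (suc j)) (λ i j → s (suc i) (suc j)) (λ i → r (suc i))
    = regroup (sumFin m (λ j → ⟦ a zero (suc j) ⟧)) _
    where
    regroup : ∀ d x → d + (d + (x + x)) ≡ (d + x) + (d + x)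
    regroup = solve-∀

double-injective : ∀ {x y} → x + x ≡ y + y → x ≡ y
double-injective {x} {y} eq = *-cancelˡ-≡ x y 2 (trans (two x) (trans eq (≡-sym (two y))))
  where
  two : ∀ x → 2 * x ≡ x + x
  two = solve-∀

module _ (G : Graph) where

  degree-punchIn : ∀ {b} (κ : Fin (suc b) → Fin (n G)) j x →
    degree G x κ ≡ ⟦ adj G x (κ j) ⟧ + degree G x (κ ∘ punchIn j)
  degree-punchIn {b} κ j x = sumFin-punchIn b j (λ y → ⟦ adj G x (κ y) ⟧)

  degree-self : ∀ {b} (κ : Fin (suc b) → Fin (n G)) j →
    degree G (κ j) κ ≡ degree G (κ j) (κ ∘ punchIn j)
  degree-self κ j = trans (degree-punchIn κ j (κ j))
    (cong (λ b → ⟦ b ⟧ + degree G (κ j) (κ ∘ punchIn j)) (irrefl G (κ j)))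

  -- Doubled, both sides are degree sums, from which any vertex can be taken out first. The edges at
  -- vertex `j` occur once in its own degree and once in the degrees of its neighbours.
  e-punchIn : ∀ {b} (κ : Fin (suc b) → Fin (n G)) j →
    e (G ∣ᵍ κ) ≡ degree G (κ j) (κ ∘ punchIn j) + e (G ∣ᵍ κ ∘ punchIn j)
  e-punchIn {b} κ j = double-injective (begin
    e (G ∣ᵍ κ) + e (G ∣ᵍ κ)
      ≡⟨ handshake (G ∣ᵍ κ) ⟨
    sumFin (suc b) (λ i → degree G (κ i) κ)
      ≡⟨ sumFin-punchIn b j (λ i → degree G (κ i) κ) ⟩
    degree G (κ j) κ + sumFin b (λ i → degree G (κ (punchIn j i)) κ)
      ≡⟨ cong₂ _+_ (degree-self κ j) (trans (sumFin-cong b λ i → trans (degree-punchIn κ j _)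
           (cong (λ c → ⟦ c ⟧ + degree G (κ (punchIn j i)) (κ ∘ punchIn j)) (sym G _ (κ j))))
           (sumFin-+ b _ _)) ⟩
    d + (d + sumFin b (λ i → degree G (κ (punchIn j i)) (κ ∘ punchIn j)))
      ≡⟨ cong (λ x → d + (d + x)) (handshake (G ∣ᵍ κ ∘ punchIn j)) ⟩
    d + (d + (x + x))
      ≡⟨ regroup d x ⟩
    d + x + (d + x) ∎)
    where
    open ≡-Reasoning
    d = degree G (κ j) (κ ∘ punchIn j)
    x = e (G ∣ᵍ κ ∘ punchIn j)
    regroup : ∀ d x → d + (d + (x + x)) ≡ (d + x) + (d + x)
    regroup = solve-∀

  -- An edge survives every deletion except those of its two ends, hence `b` of the `b + 2`
  -- deletions.
  Σ-e-punchIn : ∀ b (κ : Fin (suc (suc b)) → Fin (n G)) →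
    sumFin (suc (suc b)) (λ j → e (G ∣ᵍ κ ∘ punchIn j)) ≡ b * e (G ∣ᵍ κ)
  Σ-e-punchIn b κ = +-cancelˡ-≡ (x + x) _ _ (begin
    x + x + sumFin m (λ j → e (G ∣ᵍ κ ∘ punchIn j))
      ≡⟨ cong (_+ sumFin m (λ j → e (G ∣ᵍ κ ∘ punchIn j)))
           (trans (≡-sym (handshake (G ∣ᵍ κ))) (sumFin-cong m (degree-self κ))) ⟩
    sumFin m (λ j → degree G (κ j) (κ ∘ punchIn j)) + sumFin m (λ j → e (G ∣ᵍ κ ∘ punchIn j))
      ≡⟨ sumFin-+ m (λ j → degree G (κ j) (κ ∘ punchIn j)) (λ j → e (G ∣ᵍ κ ∘ punchIn j)) ⟨
    sumFin m (λ j → degree G (κ j) (κ ∘ punchIn j) + e (G ∣ᵍ κ ∘ punchIn j))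
      ≡⟨ sumFin-cong m (e-punchIn κ) ⟨
    sumFin m (λ _ → x)
      ≡⟨ sumFin-const m x ⟩
    m * x
      ≡⟨ +-assoc x x (b * x) ⟨
    x + x + b * x ∎)
    where
    open ≡-Reasoning
    m = suc (suc b)
    x = e (G ∣ᵍ κ)

  cross-punchIn : ∀ {a b} (ι : Fin a → Fin (n G)) (κ : Fin (suc b) → Fin (n G)) j →
    cross G ι κ ≡ degree G (κ j) ι + cross G ι (κ ∘ punchIn j)
  cross-punchIn {a} {b} ι κ j = trans
    (sumFin-cong a λ i → trans (degree-punchIn κ j (ι i))
      (cong (λ c → ⟦ c ⟧ + degree G (ι i) (κ ∘ punchIn j)) (sym G (ι i) (κ j))))
    (sumFin-+ a _ _)

  Σ-degree : ∀ {a b} (ι : Fin a → Fin (n G)) (κ : Fin b → Fin (n G)) →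
    sumFin b (λ j → degree G (κ j) ι) ≡ cross G ι κ
  Σ-degree {a} {b} ι κ = trans (sumFin-swap b a _)
    (sumFin-cong a λ i → sumFin-cong b λ j → cong ⟦_⟧ (sym G (κ j) (ι i)))

  Σ-e-∷ : ∀ {a b} (ι : Fin a → Fin (n G)) (κ : Fin b → Fin (n G)) →
    sumFin b (λ j → e (G ∣ᵍ κ j ∷ ι)) ≡ cross G ι κ + b * e (G ∣ᵍ ι)
  -- The added vertex has index `zero`, so `e (G ∣ᵍ κ j ∷ ι)` computes to
  -- `degree G (κ j) ι + e (G ∣ᵍ ι)`.
  Σ-e-∷ {b = b} ι κ = trans (sumFin-+ b (λ j → degree G (κ j) ι) (λ _ → e (G ∣ᵍ ι)))
    (cong₂ _+_ (Σ-degree ι κ) (sumFin-const b (e (G ∣ᵍ ι))))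

  degree≤ : ∀ {b} x (κ : Fin b → Fin (n G)) → degree G x κ ≤ b
  degree≤ {b} x κ = subst (degree G x κ ≤_) (*-identityʳ b)
    (sumFin-bound b 1 _ λ j → ⟦⟧≤1 (adj G x (κ j)))

  cross≤ : ∀ {a b} (ι : Fin a → Fin (n G)) (κ : Fin b → Fin (n G)) → cross G ι κ ≤ a * b
  cross≤ {a} {b} ι κ = sumFin-bound a b _ λ i → degree≤ (ι i) κ

  -- For disjoint A and B this is the number of edges induced by A ∪ B, sorted by where their ends
  -- lie.
  total : ∀ {a b} → (Fin a → Fin (n G)) → (Fin b → Fin (n G)) → ℕ
  total ι κ = e (G ∣ᵍ ι) + cross G ι κ + e (G ∣ᵍ κ)

  -- The edges from the moved vertex to A pass from the cross edges into A, and those to the rest of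
  -- B pass from B into the cross edges.
  total-move : ∀ {a b} (ι : Fin a → Fin (n G)) (κ : Fin (suc b) → Fin (n G)) j →
    total (κ j ∷ ι) (κ ∘ punchIn j) ≡ total ι κ
  total-move ι κ j rewrite e-punchIn κ j | cross-punchIn ι κ j =
    regroup (degree G (κ j) ι) _ _ _ _
    where
    regroup : ∀ c α δ γ β → c + α + (δ + γ) + β ≡ α + (c + γ) + (δ + β)
    regroup = solve-∀

record Separated {a b v} (ι : Fin a → Fin v) (κ : Fin b → Fin v) : Set where
  field
    injˡ : Injective _≡_ _≡_ ι
    injʳ : Injective _≡_ _≡_ κ
    apart : ∀ i j → ι i ≢ κ j

separated-move : ∀ {a b v} {ι : Fin a → Fin v} {κ : Fin (suc b) → Fin v} →
  Separated ι κ → ∀ j → Separated (κ j ∷ ι) (κ ∘ punchIn j)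
separated-move {ι = ι} {κ} sep j = record
  { injˡ  = λ { {zero}  {zero}  _  → refl
              ; {zero}  {suc k} eq → contradiction (≡-sym eq) (apart k j)
              ; {suc i} {zero}  eq → contradiction eq (apart i j)
              ; {suc i} {suc k} eq → cong suc (injˡ eq) }
  ; injʳ  = λ eq → punchIn-injective j _ _ (injʳ eq)
  ; apart = λ { zero k eq → punchInᵢ≢i j k (≡-sym (injʳ eq)) ; (suc i) k → apart i (punchIn j k) }
  }
  where open Separated sep

-- Splitting a dense graph

-- The rational parameters are s = `S`/`d` and t = `T`/`d` over a common denominator. Both sets are
-- nonempty, and `a`, `b` are |A| - 1 and |B| - 1.
record DenseSplit (G : Graph) (S T d : ℕ) : Set where
  field
    {a b} : ℕ
    ι     : Fin (suc a) → Fin (n G)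
    κ     : Fin (suc b) → Fin (n G)
    separated : Separated ι κ
    denseˡ : S * a < d * e (G ∣ᵍ ι)
    denseʳ : T * b < d * e (G ∣ᵍ κ)

e-pair : ∀ G (κ : Fin 2 → Fin (n G)) → e (G ∣ᵍ κ) ≤ 1
e-pair G κ with adj G (κ zero) (κ (suc zero))
... | true  = ≤-refl
... | false = z≤n

-- With B = 1 + b the values B·f j + (a+1)·g j sum up to B((B+1)α + aβ) + B(α+γ+β).
average-move : ∀ {m} b {σ d a α β γ} (f g : Fin m → ℕ) → m ≡ 3 + b →
  sumFin m f ≡ γ + m * α → sumFin m g ≡ suc b * β →
  σ * (a * (2 + b)) ≤ d * ((2 + b) * α + a * β) → σ * (a + m) < d * (α + γ + β) →
  ∃ λ j → σ * (suc a * suc b) < d * (suc b * f j + suc a * g j)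
average-move {m} b {σ} {d} {a} {α} {β} {γ} f g m≡ Σf Σg bal dense =
  above-average m (σ * (suc a * B)) (λ j → d * (B * f j + suc a * g j)) (begin-strict
    m * (σ * (suc a * B))
      ≡⟨ cong (_* (σ * (suc a * B))) m≡ ⟩
    (2 + B) * (σ * (suc a * B))
      ≡⟨ regroup₁ σ a B ⟩
    B * (σ * (a * suc B) + σ * (a + (2 + B)))
      <⟨ *-monoʳ-< B (+-mono-≤-< bal (subst (λ m → σ * (a + m) < d * (α + γ + β)) m≡ dense)) ⟩
    B * (d * (suc B * α + a * β) + d * (α + γ + β))
      ≡⟨ regroup₂ d B a α β γ ⟩
    d * (B * (γ + (2 + B) * α) + suc a * (B * β))
      ≡⟨ cong₂ (λ x y → d * (B * x + suc a * y)) (trans Σf (cong (λ m → γ + m * α) m≡)) Σg ⟨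
    d * (B * sumFin m f + suc a * sumFin m g)
      ≡⟨ cong (d *_) (cong₂ _+_ (sumFin-* m B f) (sumFin-* m (suc a) g)) ⟨
    d * (sumFin m (λ j → B * f j) + sumFin m (λ j → suc a * g j))
      ≡⟨ cong (d *_) (sumFin-+ m (λ j → B * f j) (λ j → suc a * g j)) ⟨
    d * sumFin m (λ j → B * f j + suc a * g j)
      ≡⟨ sumFin-* m d (λ j → B * f j + suc a * g j) ⟨
    sumFin m (λ j → d * (B * f j + suc a * g j)) ∎)
  where
  open ≤-Reasoning
  B = suc b
  regroup₁ : ∀ σ a B → (2 + B) * (σ * (suc a * B)) ≡ B * (σ * (a * suc B) + σ * (a + (2 + B)))
  regroup₁ = solve-∀
  regroup₂ : ∀ d B a α β γ → B * (d * (suc B * α + a * β) + d * (α + γ + β)) ≡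
    d * (B * (γ + (2 + B) * α) + suc a * (B * β))
  regroup₂ = solve-∀

-- The moved vertex brings `c` ≤ |A| = `a + 1` edges into a sparse A, so the enlarged A has at most
-- (s + 1)(`a + 1`) edges. If what is left of B is sparse as well, the balance cannot be strictly
-- exceeded.
sparse-move : ∀ S T {d a} B {c α β} → c ≤ suc a → d * α ≤ S * a → d * β ≤ T * B →
  d * (B * (c + α) + suc a * β) ≤ (S + T + d) * (suc a * B)
sparse-move S T {d} {a} B {c} {α} {β} c≤ α≤ β≤ = begin
  d * (B * (c + α) + suc a * β)
    ≡⟨ regroup₁ d B a c α β ⟩
  B * (d * c + d * α) + suc a * (d * β)
    ≤⟨ +-mono-≤ (*-monoʳ-≤ B (+-mono-≤ (*-monoʳ-≤ d c≤) (≤-trans α≤ (*-monoʳ-≤ S (n≤1+n a)))))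
                (*-monoʳ-≤ (suc a) β≤) ⟩
  B * (d * suc a + S * suc a) + suc a * (T * B)
    ≡⟨ regroup₂ S T d a B ⟩
  (S + T + d) * (suc a * B) ∎
  where
  open ≤-Reasoning
  regroup₁ : ∀ d B a c α β → d * (B * (c + α) + suc a * β) ≡ B * (d * c + d * α) + suc a * (d * β)
  regroup₁ = solve-∀
  regroup₂ : ∀ S T d a B → B * (d * suc a + S * suc a) + suc a * (T * B) ≡ (S + T + d) * (suc a * B)
  regroup₂ = solve-∀

module _ (G : Graph) {S T d : ℕ} (d≤S : d ≤ S) (d≤T : d ≤ T) where

  private
    σ = S + T + d

  -- Averaging needs |B| - 1 to stay positive after the move, so |B| ≤ 2 is treated here: a sparse
  -- A, all possible cross edges and at most `b` edges in B are too few for the assumed density.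
  -- This is where s, t ≥ 1 enter.
  few-left : ∀ {a b} (ι : Fin (suc a) → Fin (n G)) (κ : Fin b → Fin (n G)) → b ≤ 2 →
    d * e (G ∣ᵍ ι) ≤ S * a → d * total G ι κ ≤ σ * (a + b)
  few-left {a} {b} ι κ b≤2 sparse = begin
    d * (α + γ + β)
      ≡⟨ *-distribˡ-+₃ d α γ β ⟩
    d * α + (d * γ + d * β)
      ≤⟨ +-mono-≤ sparse (+-mono-≤ (*-monoʳ-≤ d (cross≤ G ι κ)) (*-monoʳ-≤ d (β≤ b b≤2 κ))) ⟩
    S * a + (d * (suc a * b) + d * b)
      ≡⟨ cong (S * a +_) (*-distribˡ-+ d (suc a * b) b) ⟨
    S * a + d * (suc a * b + b)
      ≤⟨ +-monoʳ-≤ (S * a) (*-monoʳ-≤ d (count b b≤2)) ⟩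
    S * a + d * (a + b + (a + b) + b)
      ≡⟨ regroup₁ S d a b ⟩
    S * a + d * b + d * (a + b) + d * (a + b)
      -- Of the three multiples of `d`, the first is absorbed by `S` and the second by `T`; the
      -- third is the summand `d` of `σ`.
      ≤⟨ +-monoˡ-≤ (d * (a + b)) (+-mono-≤ (+-monoʳ-≤ (S * a) (*-monoˡ-≤ b d≤S)) (*-monoˡ-≤ (a + b) d≤T)) ⟩
    S * a + S * b + T * (a + b) + d * (a + b)
      ≡⟨ regroup₂ S T d a b ⟩
    σ * (a + b) ∎
    where
    open ≤-Reasoning
    α = e (G ∣ᵍ ι)
    γ = cross G ι κ
    β = e (G ∣ᵍ κ)
    β≤ : ∀ b → b ≤ 2 → (κ : Fin b → Fin (n G)) → e (G ∣ᵍ κ) ≤ b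
    β≤ 0 _ κ = z≤n
    β≤ 1 _ κ = z≤n
    β≤ 2 _ κ = ≤-trans (e-pair G κ) (s≤s z≤n)
    β≤ (suc (suc (suc _))) (s≤s (s≤s ())) _
    -- The only quadratic term, `a * b`, is at most `2 * a` because `b ≤ 2`.
    count : ∀ b → b ≤ 2 → suc a * b + b ≤ a + b + (a + b) + b
    count 0 _ = ≤-trans (≤-reflexive (trans (+-identityʳ (suc a * 0)) (*-zeroʳ (suc a)))) z≤n
    count 1 _ = m+n≤o⇒m≤o (suc a * 1 + 1) (≤-reflexive (c₁ a))
      where
      c₁ : ∀ a → suc a * 1 + 1 + suc a ≡ a + 1 + (a + 1) + 1
      c₁ = solve-∀
    count 2 _ = m+n≤o⇒m≤o (suc a * 2 + 2) (≤-reflexive (c₂ a))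
      where
      c₂ : ∀ a → suc a * 2 + 2 + 2 ≡ a + 2 + (a + 2) + 2
      c₂ = solve-∀
    count (suc (suc (suc _))) (s≤s (s≤s ()))
    *-distribˡ-+₃ : ∀ d x y z → d * (x + y + z) ≡ d * x + (d * y + d * z)
    *-distribˡ-+₃ = solve-∀
    regroup₁ : ∀ S d a b → S * a + d * (a + b + (a + b) + b) ≡ S * a + d * b + d * (a + b) + d * (a + b)
    regroup₁ = solve-∀
    regroup₂ : ∀ S T d a b → S * a + S * b + T * (a + b) + d * (a + b) ≡ (S + T + d) * (a + b)
    regroup₂ = solve-∀

  -- A scaled form of e(A)/(|A|-1) + e(B)/(|B|-1) ≥ σ/d, meaningful also when |A| or |B| is 1.
  Balanced : ∀ {a b} → (Fin (suc a) → Fin (n G)) → (Fin (suc b) → Fin (n G)) → Set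
  Balanced {a} {b} ι κ = σ * (a * b) ≤ d * (b * e (G ∣ᵍ ι) + a * e (G ∣ᵍ κ))

  balanced-move : ∀ {a} b (ι : Fin (suc a) → Fin (n G)) (κ : Fin (2 + suc b) → Fin (n G)) →
    σ * (a + (2 + suc b)) < d * total G ι κ → Balanced ι κ →
    ∃ λ j → σ * (suc a * suc b) <
            d * (suc b * e (G ∣ᵍ κ j ∷ ι) + suc a * e (G ∣ᵍ κ ∘ punchIn j))
  balanced-move {a} b ι κ dense bal =
    average-move b {σ} {d} {a} {e (G ∣ᵍ ι)} {e (G ∣ᵍ κ)} {cross G ι κ}
      (λ j → e (G ∣ᵍ κ j ∷ ι)) (λ j → e (G ∣ᵍ κ ∘ punchIn j)) refl
      (Σ-e-∷ G ι κ) (Σ-e-punchIn G (suc b) κ) bal dense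

  -- Induction on |B| - 1. Density persists because a move changes neither `total` nor |A| + |B|;
  -- `sparse` records that A has not become dense so far.
  dense-from : ∀ b {a} (ι : Fin (suc a) → Fin (n G)) (κ : Fin (suc b) → Fin (n G)) →
    Separated ι κ → σ * (a + suc b) < d * total G ι κ → d * e (G ∣ᵍ ι) ≤ S * a → Balanced ι κ →
    DenseSplit G S T d
  dense-from 0 ι κ sep dense sparse bal = contradiction dense (≤⇒≯ (few-left ι κ (s≤s z≤n) sparse))
  dense-from 1 ι κ sep dense sparse bal = contradiction dense (≤⇒≯ (few-left ι κ ≤-refl sparse))
  dense-from (suc (suc b)) {a} ι κ sep dense sparse bal =
    let j , bal′ = balanced-move b ι κ dense bal in
    continue j bal′ (S * suc a <? d * e (G ∣ᵍ κ j ∷ ι)) (T * suc b <? d * e (G ∣ᵍ κ ∘ punchIn j))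
      λ sparse′ → dense-from (suc b) (κ j ∷ ι) (κ ∘ punchIn j) (separated-move sep j)
        (subst₂ _<_ (cong (σ *_) (+-suc a (2 + b))) (cong (d *_) (≡-sym (total-move G ι κ j))) dense)
        (≮⇒≥ sparse′) (<⇒≤ bal′)
    where
    continue : ∀ j → σ * (suc a * suc b) < d * (suc b * e (G ∣ᵍ κ j ∷ ι) + suc a * e (G ∣ᵍ κ ∘ punchIn j)) →
      Dec (S * suc a < d * e (G ∣ᵍ κ j ∷ ι)) → Dec (T * suc b < d * e (G ∣ᵍ κ ∘ punchIn j)) →
      (¬ S * suc a < d * e (G ∣ᵍ κ j ∷ ι) → DenseSplit G S T d) → DenseSplit G S T d
    continue j bal′ (no sparse′) _ move = move sparse′
    continue j bal′ (yes denseˡ) (yes denseʳ) _ = record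
      { ι = κ j ∷ ι ; κ = κ ∘ punchIn j ; separated = separated-move sep j
      ; denseˡ = denseˡ ; denseʳ = denseʳ }
    -- A was sparse before the move, so the upper bound of `sparse-move` applies and contradicts the
    -- strict inequality `bal′`.
    continue j bal′ (yes _) (no sparseʳ) _ = contradiction bal′
      (≤⇒≯ (sparse-move S T {d = d} (suc b) (degree≤ G (κ j) ι) sparse (≮⇒≥ sparseʳ)))

dense-split : ∀ G {S T d} → d ≤ S → d ≤ T → (S + T + d) * (n G ∸ 1) < d * e G → DenseSplit G S T d
dense-split record { n = 0 } {S} {T} {d} _ _ dense =
  contradiction (subst ((S + T + d) * 0 <_) (*-zeroʳ d) dense) λ ()
dense-split record { n = 1 } {S} {T} {d} _ _ dense =
  contradiction (subst ((S + T + d) * 0 <_) (*-zeroʳ d) dense) λ ()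
dense-split G@(record { n = suc (suc b) }) {S} {T} {d} d≤S d≤T dense =
  -- Initially A is the vertex `zero` and B is everything else. With |A| - 1 = 0 and no edge in A,
  -- sparsity and balance both have left side 0.
  dense-from G d≤S d≤T b ι suc
    (record { injˡ = λ { {zero} {zero} _ → refl } ; injʳ = suc-injective ; apart = λ _ _ () })
    (subst (λ x → (S + T + d) * suc b < d * (x + e (G ∣ᵍ suc))) (≡-sym (+-identityʳ (degree G zero suc))) dense)
    (≤-reflexive (trans (*-zeroʳ d) (≡-sym (*-zeroʳ S))))
    (≤-trans (≤-reflexive (*-zeroʳ (S + T + d))) z≤n)
  where
  ι : Fin 1 → Fin (suc (suc b))
  ι _ = zero

-- Minors of disjoint unions and retracts

map-just⁻ : ∀ {A B : Set} (f : A → B) m {b} → Maybe.map f m ≡ just b → ∃ λ a → m ≡ just a × f a ≡ b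
map-just⁻ f (just a) refl = a , refl , refl

walk-map : ∀ {G K : Graph} (f : Fin (n G) → Fin (n K)) {P Q} →
  (∀ {x} → P x → Q (f x)) → (∀ {x y} → adj G x y ≡ true → adj K (f x) (f y) ≡ true) →
  ∀ {x y} → WalkIn G P x y → WalkIn K Q (f x) (f y)
walk-map f p a (here px)     = here (p px)
walk-map f p a (step px α w) = step (p px) (a α) (walk-map f p a w)

walk-start : ∀ {G P x y} → WalkIn G P x y → P x
walk-start (here px)     = px
walk-start (step px _ _) = px

v-minor : ∀ {H G} → IsMinor H G → n H ≤ n G
v-minor {H} {G} M = injective⇒≤ {f = λ h → proj₁ (nonempty h)} λ {h} {h'} eq →
  just-injective (trans (≡-sym (proj₂ (nonempty h))) (trans (cong φ eq) (proj₂ (nonempty h'))))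
  where open MinorModel M

module _ {H K G : Graph} {a b} {ι : Fin a → Fin (n G)} {κ : Fin b → Fin (n G)}
  (sep : Separated ι κ) (M : IsMinor H (G ∣ᵍ ι)) (N : IsMinor K (G ∣ᵍ κ)) where

  open Separated sep
  private
    module M = MinorModel M
    module N = MinorModel N

    -- The branch sets are first indexed by the sum type, where the two models stay apart; `φ′` then
    -- renumbers them by `join`. Injectivity and disjointness of `ι` and `κ` make the preimage found
    -- by `any?` the only one.
    ψ : Fin (n G) → Maybe (Fin (n H) ⊎ Fin (n K))
    ψ x with any? (λ i → ι i ≟ꟳ x) | any? (λ j → κ j ≟ꟳ x)
    ... | yes (i , _) | _           = Maybe.map inj₁ (M.φ i)
    ... | no _        | yes (j , _) = Maybe.map inj₂ (N.φ j)
    ... | no _        | no _        = nothing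

    ψ-ι : ∀ i → ψ (ι i) ≡ Maybe.map inj₁ (M.φ i)
    ψ-ι i with any? (λ i' → ι i' ≟ꟳ ι i)
    ... | yes (i' , eq) = cong (Maybe.map inj₁ ∘ M.φ) (injˡ eq)
    ... | no ¬∃         = contradiction (i , refl) ¬∃

    ψ-κ : ∀ j → ψ (κ j) ≡ Maybe.map inj₂ (N.φ j)
    ψ-κ j with any? (λ i → ι i ≟ꟳ κ j) | any? (λ j' → κ j' ≟ꟳ κ j)
    ... | yes (i , eq) | _             = contradiction eq (apart i j)
    ... | no _         | yes (j' , eq) = cong (Maybe.map inj₂ ∘ N.φ) (injʳ eq)
    ... | no _         | no ¬∃         = contradiction (j , refl) ¬∃

    ψ-inj₁ : ∀ x {h} → ψ x ≡ just (inj₁ h) → ∃ λ i → ι i ≡ x × M.φ i ≡ just h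
    ψ-inj₁ x eq with any? (λ i → ι i ≟ꟳ x) | any? (λ j → κ j ≟ꟳ x)
    ψ-inj₁ x eq | yes (i , ιi≡x) | _ with map-just⁻ inj₁ (M.φ i) eq
    ... | _ , φi≡ , refl = i , ιi≡x , φi≡
    ψ-inj₁ x eq | no _ | yes (j , _) with map-just⁻ inj₂ (N.φ j) eq
    ... | _ , _ , ()

    ψ-inj₂ : ∀ x {k} → ψ x ≡ just (inj₂ k) → ∃ λ j → κ j ≡ x × N.φ j ≡ just k
    ψ-inj₂ x eq with any? (λ i → ι i ≟ꟳ x) | any? (λ j → κ j ≟ꟳ x)
    ψ-inj₂ x eq | yes (i , _) | _ with map-just⁻ inj₁ (M.φ i) eq
    ... | _ , _ , ()
    ψ-inj₂ x eq | no _ | yes (j , κj≡x) with map-just⁻ inj₂ (N.φ j) eq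
    ... | _ , φj≡ , refl = j , κj≡x , φj≡

    φ′ : Fin (n G) → Maybe (Fin (n (H ⊕ K)))
    φ′ x = Maybe.map (join (n H) (n K)) (ψ x)

    φ⁺ : ∀ {x} h → ψ x ≡ just (splitAt (n H) h) → φ′ x ≡ just h
    φ⁺ h eq = trans (cong (Maybe.map (join (n H) (n K))) eq) (cong just (join-splitAt (n H) (n K) h))

    φ⁻ : ∀ {x} h → φ′ x ≡ just h → ψ x ≡ just (splitAt (n H) h)
    φ⁻ {x} h eq with map-just⁻ (join (n H) (n K)) (ψ x) eq
    ... | s , ψx≡ , refl = trans ψx≡ (cong just (≡-sym (splitAt-join (n H) (n K) s)))

    ι⁺ : ∀ i {h} → M.φ i ≡ just h → ψ (ι i) ≡ just (inj₁ h)
    ι⁺ i eq = trans (ψ-ι i) (cong (Maybe.map inj₁) eq)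

    κ⁺ : ∀ j {k} → N.φ j ≡ just k → ψ (κ j) ≡ just (inj₂ k)
    κ⁺ j eq = trans (ψ-κ j) (cong (Maybe.map inj₂) eq)

    nonempty′ : ∀ s → ∃ λ x → ψ x ≡ just s
    nonempty′ (inj₁ h) = let i , eq = M.nonempty h in ι i , ι⁺ i eq
    nonempty′ (inj₂ k) = let j , eq = N.nonempty k in κ j , κ⁺ j eq

    connected′ : ∀ s x y → ψ x ≡ just s → ψ y ≡ just s → WalkIn G (λ z → ψ z ≡ just s) x y
    connected′ (inj₁ h) x y px py with ψ-inj₁ x px | ψ-inj₁ y py
    ... | i , refl , qx | j , refl , qy = walk-map ι (λ {i} → ι⁺ i) id (M.connected h i j qx qy)
    connected′ (inj₂ k) x y px py with ψ-inj₂ x px | ψ-inj₂ y py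
    ... | i , refl , qx | j , refl , qy = walk-map κ (λ {j} → κ⁺ j) id (N.connected k i j qx qy)

    edges′ : ∀ h h' → adj (H ⊕ K) h h' ≡ true →
      ∃₂ λ x y → ψ x ≡ just (splitAt (n H) h) × ψ y ≡ just (splitAt (n H) h') × adj G x y ≡ true
    edges′ h h' α with splitAt (n H) h | splitAt (n H) h'
    ... | inj₁ g | inj₁ g' = let i , j , p , q , β = M.edges g g' α in ι i , ι j , ι⁺ i p , ι⁺ j q , β
    ... | inj₂ g | inj₂ g' = let i , j , p , q , β = N.edges g g' α in κ i , κ j , κ⁺ i p , κ⁺ j q , β
    edges′ h h' () | inj₁ _ | inj₂ _
    edges′ h h' () | inj₂ _ | inj₁ _

  minor-⊕ : IsMinor (H ⊕ K) G
  minor-⊕ = record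
    { φ         = φ′
    ; nonempty  = λ h → let x , eq = nonempty′ (splitAt (n H) h) in x , φ⁺ h eq
    ; connected = λ h x y px py → walk-map id (φ⁺ h) id
                    (connected′ (splitAt (n H) h) x y (φ⁻ h px) (φ⁻ h py))
    ; edges     = λ h h' α → let x , y , p , q , β = edges′ h h' α in x , y , φ⁺ h p , φ⁺ h' q , β
    }

module _ {H W G : Graph} (ι : Fin (n G) → Fin (n W)) (π : Fin (n W) → Fin (n G))
  (π∘ι : ∀ x → π (ι x) ≡ x)
  (π-adj : ∀ x y → adj W x y ≡ true → adj G (π x) (π y) ≡ true ⊎ π x ≡ π y)
  (M : IsMinor H W) where

  open MinorModel M

  -- The map `π` contracts `W` onto `G`, and `stable` says that each branch set is closed under this
  -- retraction. A walk inside a branch set therefore projects into the same branch set, possibly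
  -- losing steps.
  minor-retract : (∀ x h → φ x ≡ just h → φ (ι (π x)) ≡ just h) → IsMinor H G
  minor-retract stable = record
    { φ         = φ ∘ ι
    ; nonempty  = λ h → let x , eq = nonempty h in π x , stable x h eq
    ; connected = λ h x y px py → subst₂ (WalkIn G _) (π∘ι x) (π∘ι y)
                    (project (λ {z} → stable z h) (connected h (ι x) (ι y) px py))
    ; edges     = edges-retract
    }
    where
    project : ∀ {P : Fin (n W) → Set} {Q : Fin (n G) → Set} → (∀ {x} → P x → Q (π x)) →
      ∀ {x y} → WalkIn W P x y → WalkIn G Q (π x) (π y)
    project q (here px) = here (q px)
    project {Q = Q} q {x} {z} (step {y = y} px α w) with π-adj x y α
    ... | inj₁ β  = step (q px) β (project q w)
    ... | inj₂ eq = subst (λ u → WalkIn G Q u (π z)) (≡-sym eq) (project q w)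

    edges-retract : ∀ h h' → adj H h h' ≡ true →
      ∃ λ x → ∃ λ y → φ (ι x) ≡ just h × φ (ι y) ≡ just h' × adj G x y ≡ true
    edges-retract h h' α with edges h h' α
    ... | x , y , p , q , β with π-adj x y β
    ...   | inj₁ γ  = π x , π y , stable x h p , stable y h' q , γ
    -- If `π` collapsed the edge, its ends would lie in one branch set, and `H` would have a loop.
    ...   | inj₂ eq with just-injective (trans (≡-sym (stable x h p)) (trans (cong (φ ∘ ι) eq) (stable y h' q)))
    ...     | refl = contradiction (trans (≡-sym α) (irrefl H h)) λ ()

-- Gluing at a cut vertex

-- Here `m` names the branch set containing the cut vertex, if there is one. Connectedness of `H`
-- covers `nothing`, and connectedness after deleting one vertex covers `just h`.
two-connected-avoiding : ∀ {H} → TwoConnected H → ∀ m →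
  ConnectedIn H (λ h → m ≢ just h) × ∃ λ h → m ≢ just h
two-connected-avoiding {record { n = suc (suc _) }} (_ , (_ , conn) , _) nothing =
  (λ x y _ _ → walk-map id (λ _ ()) id (conn x y tt tt)) , zero , λ ()
two-connected-avoiding {record { n = suc (suc _) }} (_ , _ , cut) (just h) =
  (λ x y px py → walk-map id (λ g≢h eq → g≢h (≡-sym (just-injective eq))) id
    (cut h x y (px ∘ cong just ∘ ≡-sym) (py ∘ cong just ∘ ≡-sym))) , other h
  where
  other : ∀ {m} (h : Fin (suc (suc m))) → ∃ λ g → just h ≢ just g
  other zero    = suc zero , λ ()
  other (suc h) = zero , λ ()
two-connected-avoiding {record { n = 0 }} (() , _) _
two-connected-avoiding {record { n = 1 }} (s≤s () , _) _

module _ {H W : Graph} (H₂ : TwoConnected H) (ρ : Fin (n W)) (side : Fin (n W) → Bool)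
  (side-adj : ∀ x y → adj W x y ≡ true → x ≢ ρ → y ≢ ρ → side x ≡ side y)
  (M : IsMinor H W) where

  open MinorModel M

  -- At most one branch set contains the cut vertex, and H minus the corresponding vertex is connected.
  minor-one-sided : ∃ λ σ → ∀ x h → φ ρ ≢ just h → φ x ≡ just h → side x ≡ σ
  minor-one-sided =
    let conn , h₀ , ρ∌h₀ = two-connected-avoiding H₂ (φ ρ)
        x₀ , φx₀≡ = nonempty h₀
    in side x₀ , λ x h ρ∌h φx≡ → along (conn h h₀ ρ∌h ρ∌h₀) φx≡ φx₀≡
    where
    off-ρ : ∀ {x h} → φ ρ ≢ just h → φ x ≡ just h → x ≢ ρ
    off-ρ ρ∌h φx≡ refl = ρ∌h φx≡

    within : ∀ {h x y} → φ ρ ≢ just h → WalkIn W (λ z → φ z ≡ just h) x y → side x ≡ side y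
    within ρ∌h (here _) = refl
    within ρ∌h (step px α w) = trans (side-adj _ _ α (off-ρ ρ∌h px) (off-ρ ρ∌h (walk-start w))) (within ρ∌h w)

    -- Each edge of the walk in `H` is realised by an edge of `W` off `ρ`, which carries the side
    -- from one branch set to the next.
    along : ∀ {h h' x y} → WalkIn H (λ h → φ ρ ≢ just h) h h' →
      φ x ≡ just h → φ y ≡ just h' → side x ≡ side y
    along {h} (here ρ∌h) φx≡ φy≡ = within ρ∌h (connected h _ _ φx≡ φy≡)
    along {h} (step {y = g} ρ∌h α w) φx≡ φy≡ =
      let u , v , φu≡ , φv≡ , β = edges h g α in
      trans (within ρ∌h (connected h _ u φx≡ φu≡))
        (trans (side-adj u v β (off-ρ ρ∌h φu≡) (off-ρ (walk-start w) φv≡)) (along w φv≡ φy≡))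

-- With the number of vertices as an index, the existence of the vertex `zero` used for gluing is
-- part of the type.
record GraphOn (N : ℕ) : Set where
  field
    rel        : Fin N → Fin N → Bool
    rel-sym    : ∀ x y → rel x y ≡ rel y x
    rel-irrefl : ∀ x → rel x x ≡ false
open GraphOn

graph : ∀ {N} → GraphOn N → Graph
graph A = record { adj = rel A ; sym = rel-sym A ; irrefl = rel-irrefl A }

module _ {m p} (A : GraphOn (suc m)) (B : GraphOn (suc p)) where

  private
    V = Fin (suc m) ⊎ Fin p

    -- `inj₁ zero` plays the role of `zero` in both graphs, and `inj₂ y` stands for the vertex
    -- `suc y` of `B`.
    grel : V → V → Bool
    grel (inj₁ x)       (inj₁ y)       = rel A x y
    grel (inj₂ x)       (inj₂ y)       = rel B (suc x) (suc y)
    grel (inj₁ zero)    (inj₂ y)       = rel B zero (suc y)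
    grel (inj₁ (suc _)) (inj₂ y)       = false
    grel (inj₂ x)       (inj₁ zero)    = rel B (suc x) zero
    grel (inj₂ x)       (inj₁ (suc _)) = false

    grel-sym : ∀ x y → grel x y ≡ grel y x
    grel-sym (inj₁ x)       (inj₁ y)       = rel-sym A x y
    grel-sym (inj₂ x)       (inj₂ y)       = rel-sym B (suc x) (suc y)
    grel-sym (inj₁ zero)    (inj₂ y)       = rel-sym B zero (suc y)
    grel-sym (inj₁ (suc _)) (inj₂ y)       = refl
    grel-sym (inj₂ x)       (inj₁ zero)    = rel-sym B (suc x) zero
    grel-sym (inj₂ x)       (inj₁ (suc _)) = refl

    grel-irrefl : ∀ x → grel x x ≡ false
    grel-irrefl (inj₁ x) = rel-irrefl A x
    grel-irrefl (inj₂ x) = rel-irrefl B (suc x)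

    part : Fin (suc m + p) → V
    part = splitAt (suc m)

  -- A and B share the vertex zero.
  glue : GraphOn (suc (m + p))
  glue = record
    { rel        = λ x y → grel (part x) (part y)
    ; rel-sym    = λ x y → grel-sym (part x) (part y)
    ; rel-irrefl = λ x → grel-irrefl (part x)
    }

  -- In the degree sum, the degree of the shared vertex is the sum of its degrees in `A` and `B`;
  -- every other vertex keeps its degree.
  e-glue : e (graph glue) ≡ e (graph A) + e (graph B)
  e-glue = double-injective (begin
    e (graph glue) + e (graph glue)
      ≡⟨ handshake (graph glue) ⟨
    sumFin (suc m + p) (λ x → sumFin (suc m + p) (λ y → ⟦ grel (part x) (part y) ⟧))
      ≡⟨ split-part (λ s → sumFin (suc m + p) (λ y → ⟦ grel s (part y) ⟧)) ⟩
    sumFin (suc m) (λ x → sumFin (suc m + p) (λ y → ⟦ grel (inj₁ x) (part y) ⟧)) +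
    sumFin p (λ x → sumFin (suc m + p) (λ y → ⟦ grel (inj₂ x) (part y) ⟧))
      ≡⟨ cong₂ _+_ (sumFin-cong (suc m) λ x → split-part (λ s → ⟦ grel (inj₁ x) s ⟧))
                   (sumFin-cong p λ x → split-part (λ s → ⟦ grel (inj₂ x) s ⟧)) ⟩
    sumFin (suc m) (λ x → degree (graph A) x id + sumFin p (λ y → ⟦ grel (inj₁ x) (inj₂ y) ⟧)) +
    sumFin p (λ x → (⟦ rel B (suc x) zero ⟧ + sumFin m (λ _ → 0)) + sumFin p (λ y → ⟦ rel B (suc x) (suc y) ⟧))
      ≡⟨ cong₂ _+_ (sumFin-+ (suc m) (λ x → degree (graph A) x id) (λ x → sumFin p (λ y → ⟦ grel (inj₁ x) (inj₂ y) ⟧)))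
                   (sumFin-cong p λ x → cong (_+ sumFin p (λ y → ⟦ rel B (suc x) (suc y) ⟧))
                     (trans (cong (⟦ rel B (suc x) zero ⟧ +_) (sumFin-zero m)) (+-identityʳ _))) ⟩
    sumFin (suc m) (λ x → degree (graph A) x id) + (D + sumFin m (λ _ → sumFin p (λ _ → 0))) +
    sumFin p (λ x → degree (graph B) (suc x) id)
      -- Only the row of the shared vertex has entries towards `B`. Its loop entry 0 in `B`
      -- completes `D` to a full degree.
      ≡⟨ cong (λ z → sumFin (suc m) (λ x → degree (graph A) x id) + z + sumFin p (λ x → degree (graph B) (suc x) id))
           (trans (cong (D +_) (trans (sumFin-cong m λ _ → sumFin-zero p) (sumFin-zero m)))
           (trans (+-identityʳ D) (≡-sym (cong (λ b → ⟦ b ⟧ + D) (rel-irrefl B zero))))) ⟩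
    sumFin (suc m) (λ x → degree (graph A) x id) + degree (graph B) zero id + sumFin p (λ x → degree (graph B) (suc x) id)
      ≡⟨ +-assoc (sumFin (suc m) (λ x → degree (graph A) x id)) _ _ ⟩
    sumFin (suc m) (λ x → degree (graph A) x id) + sumFin (suc p) (λ x → degree (graph B) x id)
      ≡⟨ cong₂ _+_ (handshake (graph A)) (handshake (graph B)) ⟩
    (e (graph A) + e (graph A)) + (e (graph B) + e (graph B))
      ≡⟨ interchange (e (graph A)) (e (graph B)) ⟩
    (e (graph A) + e (graph B)) + (e (graph A) + e (graph B)) ∎)
    where
    open ≡-Reasoning
    D = sumFin p (λ y → ⟦ rel B zero (suc y) ⟧)
    interchange : ∀ a b → (a + a) + (b + b) ≡ (a + b) + (a + b)
    interchange = solve-∀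
    split-part : (f : V → ℕ) → sumFin (suc m + p) (λ x → f (part x)) ≡
      sumFin (suc m) (λ i → f (inj₁ i)) + sumFin p (λ j → f (inj₂ j))
    split-part f = trans (sumFin-split (suc m) p (λ x → f (part x)))
      (cong₂ _+_ (sumFin-cong (suc m) λ i → cong f (splitAt-↑ˡ (suc m) i p))
                 (sumFin-cong p λ j → cong f (splitAt-↑ʳ (suc m) p j)))

  private
    W = graph glue

    ιᴬ : Fin (suc m) → Fin (n W)
    ιᴬ = _↑ˡ p

    πᴬ : Fin (n W) → Fin (suc m)
    πᴬ x = [ id , const zero ]′ (part x)

    πᴬ-adj : ∀ x y → adj W x y ≡ true → rel A (πᴬ x) (πᴬ y) ≡ true ⊎ πᴬ x ≡ πᴬ y
    πᴬ-adj x y α with part x | part y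
    ... | inj₁ i       | inj₁ j       = inj₁ α
    ... | inj₂ i       | inj₂ j       = inj₂ refl
    ... | inj₁ zero    | inj₂ j       = inj₂ refl
    ... | inj₂ i       | inj₁ zero    = inj₂ refl
    πᴬ-adj x y () | inj₁ (suc i) | inj₂ j
    πᴬ-adj x y () | inj₂ i       | inj₁ (suc j)

    ιᴮ : Fin (suc p) → Fin (n W)
    ιᴮ zero    = zero
    ιᴮ (suc j) = suc m ↑ʳ j

    πᴮ : Fin (n W) → Fin (suc p)
    πᴮ x = [ const zero , suc ]′ (part x)

    πᴮ∘ιᴮ : ∀ x → πᴮ (ιᴮ x) ≡ x
    πᴮ∘ιᴮ zero    = refl
    πᴮ∘ιᴮ (suc j) = cong [ const zero , suc ]′ (splitAt-↑ʳ (suc m) p j)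

    πᴮ-adj : ∀ x y → adj W x y ≡ true → rel B (πᴮ x) (πᴮ y) ≡ true ⊎ πᴮ x ≡ πᴮ y
    πᴮ-adj x y α with part x | part y
    ... | inj₁ i       | inj₁ j       = inj₂ refl
    ... | inj₂ i       | inj₂ j       = inj₁ α
    ... | inj₁ zero    | inj₂ j       = inj₁ α
    ... | inj₂ i       | inj₁ zero    = inj₁ α
    πᴮ-adj x y () | inj₁ (suc i) | inj₂ j
    πᴮ-adj x y () | inj₂ i       | inj₁ (suc j)

    -- The shared vertex is labelled `true` by convention; `side-adj` concerns edges away from it.
    side : Fin (n W) → Bool
    side x = [ const true , const false ]′ (part x)

    side-adj : ∀ x y → adj W x y ≡ true → x ≢ zero → y ≢ zero → side x ≡ side y
    side-adj x y α x≢0 y≢0 with part x in eqx | part y in eqy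
    ... | inj₁ _    | inj₁ _    = refl
    ... | inj₂ _    | inj₂ _    = refl
    ... | inj₁ zero | inj₂ _    = contradiction (≡-sym (splitAt⁻¹-↑ˡ eqx)) x≢0
    ... | inj₂ _    | inj₁ zero = contradiction (≡-sym (splitAt⁻¹-↑ˡ eqy)) y≢0
    side-adj x y () x≢0 y≢0 | inj₁ (suc _) | inj₂ _
    side-adj x y () x≢0 y≢0 | inj₂ _       | inj₁ (suc _)

  -- All branch sets avoiding the shared vertex lie on one side. Contracting the other side to the
  -- shared vertex then only shrinks the branch set that contains this vertex.
  minor-glue : ∀ {H} → TwoConnected H → IsMinor H (graph glue) → IsMinor H (graph A) ⊎ IsMinor H (graph B)
  minor-glue {H} H₂ M with minor-one-sided H₂ zero side side-adj M
  ... | true  , sided = inj₁ (minor-retract ιᴬ πᴬ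
    (λ x → cong [ id , const zero ]′ (splitAt-↑ˡ (suc m) x p)) πᴬ-adj M stable)
    where
    open MinorModel M
    stable : ∀ x h → φ x ≡ just h → φ (ιᴬ (πᴬ x)) ≡ just h
    stable x h φx≡ with part x in eq | ≡-dec _≟ꟳ_ (φ zero) (just h)
    ... | inj₁ i | _       = trans (cong φ (splitAt⁻¹-↑ˡ eq)) φx≡
    ... | inj₂ j | yes φ0≡ = φ0≡
    -- The vertex `x` lies strictly inside `B`, while its branch set avoids `zero` and so is
    -- confined to the side of `A`.
    ... | inj₂ j | no  φ0≢ = contradiction
      (trans (≡-sym (sided x h φ0≢ φx≡)) (cong [ const true , const false ]′ eq)) λ ()
  ... | false , sided = inj₂ (minor-retract ιᴮ πᴮ πᴮ∘ιᴮ πᴮ-adj M stable)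
    where
    open MinorModel M
    stable : ∀ x h → φ x ≡ just h → φ (ιᴮ (πᴮ x)) ≡ just h
    stable x h φx≡ with part x in eq | ≡-dec _≟ꟳ_ (φ zero) (just h)
    ... | inj₂ j | _       = trans (cong φ (splitAt⁻¹-↑ʳ eq)) φx≡
    ... | inj₁ i | yes φ0≡ = φ0≡
    ... | inj₁ i | no  φ0≢ = contradiction
      (trans (≡-sym (sided x h φ0≢ φx≡)) (cong [ const true , const false ]′ eq)) λ ()

-- Many copies glued at one vertex

point : GraphOn 1
point = record { rel = λ _ _ → false ; rel-sym = λ _ _ → refl ; rel-irrefl = λ _ → refl }

-- A further copy adds only `p` vertices, so e(G) and v(G) - 1 both grow in proportion to `j`.
copies : ∀ {p} → GraphOn (suc p) → ∀ j → GraphOn (suc (j * p))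
copies A zero    = point
copies A (suc j) = glue A (copies A j)

e-copies : ∀ {p} (A : GraphOn (suc p)) j → e (graph (copies A j)) ≡ j * e (graph A)
e-copies A zero    = refl
e-copies A (suc j) = trans (e-glue A (copies A j)) (cong (e (graph A) +_) (e-copies A j))

copies-minor-free : ∀ {H p} (A : GraphOn (suc p)) → TwoConnected H →
  ¬ IsMinor H (graph A) → ∀ j → ¬ IsMinor H (graph (copies A j))
copies-minor-free A H₂@(3≤n , _) ∌H zero M = contradiction (≤-trans 3≤n (v-minor M)) λ { (s≤s ()) }
copies-minor-free A H₂ ∌H (suc j) M =
  [ ∌H , copies-minor-free A H₂ ∌H j ]′ (minor-glue A (copies A j) H₂ M)

-- c(H) ≤ S/d with e(G)/v(G) replaced by e(G)/(v(G) - 1).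
record RatioBound (H : Graph) (S d : ℕ) : Set where
  field
    edges≤ : ∀ G → ¬ IsMinor H G → d * e G ≤ S * (n G ∸ 1)
open RatioBound public

ratioBound : ∀ {H S d} → TwoConnected H →
  (∀ G → 1 ≤ n G → ¬ IsMinor H G → d * e G ≤ S * n G) → RatioBound H S d
ratioBound {d = d} H₂ bound .edges≤ record { n = zero } ∌H = ≤-trans (≤-reflexive (*-zeroʳ d)) z≤n
ratioBound {H} {S} {d} H₂ bound .edges≤ G@(record { n = suc p ; adj = a ; sym = s ; irrefl = r }) ∌H =
  ≮⇒≥ λ Sp<de → <-irrefl refl (begin-strict
    S + j * (S * p)
      <⟨ +-monoˡ-< (j * (S * p)) (n<1+n S) ⟩
    j + j * (S * p)
      ≡⟨ *-suc j (S * p) ⟨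
    j * suc (S * p)
      ≤⟨ *-monoʳ-≤ j Sp<de ⟩
    j * (d * e G)
      ≡⟨ swap j d (e G) ⟩
    d * (j * e G)
      ≡⟨ cong (d *_) (e-copies A j) ⟨
    d * e (graph (copies A j))
      ≤⟨ bound (graph (copies A j)) (s≤s z≤n) (copies-minor-free A H₂ ∌H j) ⟩
    S * suc (j * p)
      ≡⟨ regroup S j p ⟩
    S + j * (S * p) ∎)
  where
  open ≤-Reasoning
  -- If `d * e G` were at least `S * p + 1`, the `j` copies would gain an excess of `j` over
  -- `j * (S * p)`, while the bound allows an excess of only `S`; hence `S + 1` copies.
  j = suc S
  A : GraphOn (suc p)
  A = record { rel = a ; rel-sym = s ; rel-irrefl = r }
  swap : ∀ j d x → j * (d * x) ≡ d * (j * x)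
  swap = solve-∀
  regroup : ∀ S j p → S * suc (j * p) ≡ S + j * (S * p)
  regroup = solve-∀

-- Rational bounds

-- Each half of a dense split is too dense to exclude its graph, and models in disjoint halves
-- combine. Being a minor is not decided: the models `M` and `N` are assumed inside nested
-- refutations.
ratioBound-⊕ : ∀ {H K S T d} → d ≤ S → d ≤ T →
  RatioBound H S d → RatioBound K T d → RatioBound (H ⊕ K) (S + T + d) d
ratioBound-⊕ d≤S d≤T boundH boundK .edges≤ G ∌H⊕K = ≮⇒≥ λ dense →
  let open DenseSplit (dense-split G d≤S d≤T dense) in
  <⇒≱ denseˡ (boundH .edges≤ (G ∣ᵍ ι) λ M →
  <⇒≱ denseʳ (boundK .edges≤ (G ∣ᵍ κ) λ N → ∌H⊕K (minor-⊕ separated M N)))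

ratioBound-scale : ∀ {H S d} c → RatioBound H S d → RatioBound H (c * S) (c * d)
ratioBound-scale {S = S} {d} c bound .edges≤ G ∌H = subst₂ _≤_ (≡-sym (*-assoc c d _)) (≡-sym (*-assoc c S _))
  (*-monoʳ-≤ c (bound .edges≤ G ∌H))

-- `K₂` has one edge and v - 1 = 1, and is too small to contain `H`.
ratioBound≥1 : ∀ {H S d} → 3 ≤ n H → RatioBound H S d → d ≤ S
ratioBound≥1 {H} {S} {d} 3≤n bound = subst₂ _≤_ (*-identityʳ d) (*-identityʳ S)
  (bound .edges≤ K₂ λ M → contradiction (≤-trans 3≤n (v-minor M)) λ { (s≤s (s≤s ())) })
  where
  K₂ : Graph
  K₂ = record
    { n      = 2
    ; adj    = λ { zero zero → false ; zero (suc _) → true ; (suc _) zero → true ; (suc _) (suc _) → false }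
    ; sym    = λ { zero zero → refl ; zero (suc _) → refl ; (suc _) zero → refl ; (suc _) (suc _) → refl }
    ; irrefl = λ { zero → refl ; (suc _) → refl }
    }

toℚᵘ-ℕ : ∀ x → toℚᵘ (ℕtoℚ x) ℚᵘ.≃ mkℚᵘ (pos x) 0
toℚᵘ-ℕ x = ℚ.toℚᵘ-fromℚᵘ (mkℚᵘ (pos x) 0)

module _ q S d (q≃ : toℚᵘ q ℚᵘ.≃ mkℚᵘ (pos S) d) {x y : ℕ} where

  private
    rhs≃ : toℚᵘ (q ℚ.* ℕtoℚ y) ℚᵘ.≃ mkℚᵘ (pos S) d ℚᵘ.* mkℚᵘ (pos y) 0
    rhs≃ = ℚᵘ.≃-trans (ℚ.toℚᵘ-homo-* q (ℕtoℚ y)) (ℚᵘ.*-cong q≃ (toℚᵘ-ℕ y))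

    lhs≡ : pos x ℤ.* (pos (suc d * 1)) ≡ pos (suc d * x)
    lhs≡ = trans (≡-sym (ℤ.pos-* x (suc d * 1))) (cong pos (comm x (suc d)))
      where
      comm : ∀ x d → x * (d * 1) ≡ d * x
      comm = solve-∀

    rhs≡ : pos S ℤ.* pos y ℤ.* pos 1 ≡ pos (S * y)
    rhs≡ = trans (ℤ.*-identityʳ _) (≡-sym (ℤ.pos-* S y))

  ≤⇒ratio : ℕtoℚ x ℚ.≤ q ℚ.* ℕtoℚ y → suc d * x ≤ S * y
  ≤⇒ratio x≤qy = ℤ.drop‿+≤+ (subst₂ ℤ._≤_ lhs≡ rhs≡ (ℚᵘ.drop-*≤*
    (ℚᵘ.≤-respˡ-≃ (toℚᵘ-ℕ x) (ℚᵘ.≤-respʳ-≃ rhs≃ (ℚ.toℚᵘ-mono-≤ x≤qy)))))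

  ratio⇒≤ : suc d * x ≤ S * y → ℕtoℚ x ℚ.≤ q ℚ.* ℕtoℚ y
  ratio⇒≤ dx≤Sy = ℚ.toℚᵘ-cancel-≤ (ℚᵘ.≤-respˡ-≃ (ℚᵘ.≃-sym (toℚᵘ-ℕ x)) (ℚᵘ.≤-respʳ-≃ (ℚᵘ.≃-sym rhs≃)
    (*≤* (subst₂ ℤ._≤_ (≡-sym lhs≡) (≡-sym rhs≡) (+≤+ dx≤Sy)))))

-- `mkℚᵘ` stores the denominator minus one, hence `suc d`. The fraction may be unreduced, which
-- permits common denominators.
StrongBound : Graph → ℚ → Set
StrongBound H q = ∃₂ λ S d → toℚᵘ q ℚᵘ.≃ mkℚᵘ (pos S) d × RatioBound H S (suc d)

strongBound : ∀ {H q} → TwoConnected H → cBound H q → StrongBound H q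
strongBound {H} {q@(mkℚ (pos S) d _)} H₂ bound =
  S , d , ℚᵘ.≃-refl , ratioBound H₂ λ G 1≤n ∌H → ≤⇒ratio q S d ℚᵘ.≃-refl (bound G 1≤n ∌H)
strongBound {H} {q@(mkℚ -[1+ _ ] _ _)} (3≤n , _) bound = contradiction q≥0 λ ()
  where
  q≥0 : ℚ.NonNegative q
  -- The one-vertex graph has ratio 0, so no negative `q` is an upper bound.
  q≥0 = ℚ.nonNegative (subst (ℚ.0ℚ ℚ.≤_) (ℚ.*-identityʳ q) (bound (graph point) ≤-refl
    λ M → contradiction (≤-trans 3≤n (v-minor M)) λ { (s≤s ()) }))

cBound-strong : ∀ {H q} → StrongBound H q → cBound H q
cBound-strong {q = q} (S , d , q≃ , bound) G _ ∌H =
  ratio⇒≤ q S d q≃ (≤-trans (bound .edges≤ G ∌H) (*-monoʳ-≤ S (m∸n≤m (n G) 1)))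

strongBound-⊕ : ∀ {H K p q} → 3 ≤ n H → 3 ≤ n K → StrongBound H p → StrongBound K q →
  StrongBound (H ⊕ K) (p ℚ.+ q ℚ.+ 1ℚ)
strongBound-⊕ {H} {K} {p} {q} 3≤H 3≤K (S , d , p≃ , boundH) (T , f , q≃ , boundK) =
  -- Over the common denominator `suc f * suc d`, the last summand is the added 1; `d + f * suc d`
  -- is that denominator minus one.
  suc f * S + suc d * T + suc f * suc d , d + f * suc d ,
  ℚᵘ.≃-trans (ℚ.toℚᵘ-homo-+ (p ℚ.+ q) 1ℚ) (ℚᵘ.≃-trans
    (ℚᵘ.+-congˡ (toℚᵘ 1ℚ) (ℚᵘ.≃-trans (ℚ.toℚᵘ-homo-+ p q) (ℚᵘ.+-cong p≃ q≃))) (*≡* cross≡)) ,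
  ratioBound-⊕ (ratioBound≥1 3≤H boundH′) (ratioBound≥1 3≤K boundK′) boundH′ boundK′
  where
  boundH′ : RatioBound H (suc f * S) (suc f * suc d)
  boundH′ = ratioBound-scale (suc f) boundH
  boundK′ : RatioBound K (suc d * T) (suc f * suc d)
  boundK′ = subst (RatioBound K (suc d * T)) (*-comm (suc d) (suc f)) (ratioBound-scale (suc d) boundK)
  cross≡ :
    ((pos S ℤ.* pos (suc f) ℤ.+ pos T ℤ.* pos (suc d)) ℤ.* pos 1 ℤ.+ pos 1 ℤ.* pos (suc d * suc f))
      ℤ.* pos (suc f * suc d) ≡
    pos (suc f * S + suc d * T + suc f * suc d) ℤ.* pos (suc d * suc f * 1)
  cross≡ = cong₂ ℤ._*_
    (trans (cong₂ ℤ._+_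
             (trans (ℤ.*-identityʳ _)
                    (cong₂ ℤ._+_ (≡-sym (ℤ.pos-* S (suc f))) (≡-sym (ℤ.pos-* T (suc d)))))
             (ℤ.*-identityˡ (pos (suc d * suc f))))
           (cong pos (num S T (suc d) (suc f))))
    (cong pos (den (suc d) (suc f)))
    where
    num : ∀ S T d f → S * f + T * d + d * f ≡ f * S + d * T + f * d
    num = solve-∀
    den : ∀ d f → f * d ≡ d * f * 1
    den = solve-∀

ℕtoℚ-suc : ∀ k → ℕtoℚ (suc k) ≡ ℕtoℚ k ℚ.+ 1ℚ
ℕtoℚ-suc k = ℚ.toℚᵘ-injective (begin
  toℚᵘ (ℕtoℚ (suc k))            ≈⟨ toℚᵘ-ℕ (suc k) ⟩
  mkℚᵘ (pos (suc k)) 0           ≈⟨ *≡* (cong (ℤ._* pos 1) suc≡) ⟩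
  mkℚᵘ (pos k) 0 ℚᵘ.+ toℚᵘ 1ℚ    ≈⟨ ℚᵘ.+-congˡ (toℚᵘ 1ℚ) (toℚᵘ-ℕ k) ⟨
  toℚᵘ (ℕtoℚ k) ℚᵘ.+ toℚᵘ 1ℚ     ≈⟨ ℚ.toℚᵘ-homo-+ (ℕtoℚ k) 1ℚ ⟨
  toℚᵘ (ℕtoℚ k ℚ.+ 1ℚ)           ∎)
  where
  open SetoidReasoning ℚᵘ.≃-setoid
  suc≡ : pos (suc k) ≡ pos k ℤ.* pos 1 ℤ.+ pos 1
  suc≡ = trans (cong pos (+-comm 1 k)) (cong (ℤ._+ pos 1) (≡-sym (ℤ.*-identityʳ (pos k))))

-- The induction carries the bound by v(G) - 1, since a union of several parts is disconnected and
-- gluing could not recover this form from `cBound`.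
strongBound-⋃ : ∀ k (Hs : Fin (suc k) → Graph) → (∀ i → TwoConnected (Hs i)) →
  (qs : Fin (suc k) → ℚ) → (∀ i → cBound (Hs i) (qs i)) →
  StrongBound (⋃ (suc k) Hs) (sumℚ (suc k) qs ℚ.+ (ℕtoℚ (suc k) - 1ℚ))
strongBound-⋃ zero Hs H₂ qs bounds =
  let S , d , q≃ , bound = strongBound {q = qs zero} (H₂ zero) (bounds zero) in
  S , d , subst (λ q → toℚᵘ q ℚᵘ.≃ mkℚᵘ (pos S) d) (≡-sym q≡) q≃ ,
  -- The union of one graph is `Hs zero ⊕ emptyGraph`, so the model is completed by an empty model
  -- on no vertices.
  record { edges≤ = λ G ∌⋃ → bound .edges≤ G λ M → ∌⋃ (minor-⊕ id-separated M (emptyMinor G)) }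
  where
  q≡ : qs zero ℚ.+ ℚ.0ℚ ℚ.+ (ℕtoℚ 1 - 1ℚ) ≡ qs zero
  q≡ = trans (ℚ.+-identityʳ _) (ℚ.+-identityʳ _)
  id-separated : ∀ {m} → Separated {m} {0} id (λ ())
  id-separated = record { injˡ = id ; injʳ = λ { {()} } ; apart = λ _ () }
  emptyMinor : ∀ G → IsMinor emptyGraph (G ∣ᵍ λ ())
  emptyMinor G = record { φ = λ () ; nonempty = λ () ; connected = λ () ; edges = λ () }
strongBound-⋃ (suc k) Hs H₂ qs bounds =
  subst (StrongBound (⋃ (suc (suc k)) Hs)) q≡
    (strongBound-⊕ {p = qs zero} (proj₁ (H₂ zero)) (≤-trans (proj₁ (H₂ (suc zero))) (m≤m+n _ _))
      (strongBound {q = qs zero} (H₂ zero) (bounds zero))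
      (strongBound-⋃ k (Hs ∘ suc) (H₂ ∘ suc) (qs ∘ suc) (bounds ∘ suc)))
  where
  q≡ : qs zero ℚ.+ (sumℚ (suc k) (qs ∘ suc) ℚ.+ (ℕtoℚ (suc k) - 1ℚ)) ℚ.+ 1ℚ ≡
    qs zero ℚ.+ sumℚ (suc k) (qs ∘ suc) ℚ.+ (ℕtoℚ (suc (suc k)) - 1ℚ)
  q≡ = trans (regroup (qs zero) (sumℚ (suc k) (qs ∘ suc)) (ℕtoℚ (suc k)) 1ℚ)
    (cong (λ x → qs zero ℚ.+ sumℚ (suc k) (qs ∘ suc) ℚ.+ (x - 1ℚ)) (≡-sym (ℕtoℚ-suc (suc k))))
    where
    open +-*-Solver
    regroup : ∀ p q r s → p ℚ.+ (q ℚ.+ (r - s)) ℚ.+ s ≡ p ℚ.+ q ℚ.+ ((r ℚ.+ s) - s)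
    regroup = solve 4 (λ p q r s → p :+ (q :+ (r :- s)) :+ s := p :+ q :+ ((r :+ s) :- s)) refl

theorem1p4 : (k : ℕ) → 1 ≤ k → (Hs : Fin k → Graph) →
    (∀ i → TwoConnected (Hs i)) →
    (qs : Fin k → ℚ) → (∀ i → cBound (Hs i) (qs i)) →
    cBound (⋃ k Hs) (sumℚ k qs ℚ.+ (ℕtoℚ k - 1ℚ))
theorem1p4 (suc k) _ Hs H₂ qs bounds = cBound-strong (strongBound-⋃ k Hs H₂ qs bounds)
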